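{- For every $n\geq 1$, $$E(M_N^C(n))=1+\frac{2n}{N+1}+\frac{4n(n-1)}{(N+1)^2}+O\left(\frac{1}{(N+1)^3}\right)\quad\text{as } N\to\infty.$$
   Context: For integers $n\geq1$, $N\geq 2$, consider cubes $z+[0,1]^n$ with $z\in\{0,\frac1N,\dots,1\}^n$ inside $[0,2]^n$; two such cubes $z+[0,1]^n$, $z'+[0,1]^n$ are non-overlapping iff there is $i$ with $\{z_i,z'_i\}=\{0,1\}$. The sequential random discrete cube packing process starts with the empty packing and repeatedly adds a cube chosen uniformly at random among all such cubes not overlapping those already placed, until no cube can be added. $M_N^C(n)$ is the random number of cubes in the final packing and $E(M_N^C(n))$ its expectation. -}

module Defs where

open import Data.Nat as ℕ using (ℕ; zero; suc; _≡ᵇ_)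
open import Data.Bool using (Bool; true; false; _∧_; _∨_; if_then_else_)
open import Data.List using (List; []; _∷_; map; concatMap; upTo; filter; length; foldr)
open import Data.Vec using (Vec; []; _∷_)
open import Data.Integer using (+_)
open import Data.Rational using (ℚ; _+_; _*_; _/_)
open import Relation.Nullary.Decidable using (Dec)
open import Data.Bool using (T)
open import Data.Bool.Properties using (T?)

-- Cube positions z ∈ {0, 1/N, …, 1}^n are encoded by their numerators:
-- Vec ℕ n with entries in {0, …, N} (z_i = k_i / N).
grid : (N n : ℕ) → List (Vec ℕ n)
grid N zero    = [] ∷ []
grid N (suc n) = concatMap (λ a → map (a ∷_) (grid N n)) (upTo (suc N))

sepCoord : ℕ → ℕ → ℕ → Bool
sepCoord N a b = ((a ≡ᵇ 0) ∧ (b ≡ᵇ N)) ∨ ((a ≡ᵇ N) ∧ (b ≡ᵇ 0))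

nonOverlap : (N : ℕ) {n : ℕ} → Vec ℕ n → Vec ℕ n → Bool
nonOverlap N []       []         = false
nonOverlap N (a ∷ as) (b ∷ bs)   = sepCoord N a b ∨ nonOverlap N as bs

addable : (N : ℕ) {n : ℕ} → List (Vec ℕ n) → Vec ℕ n → Bool
addable N P z = foldr (λ w r → nonOverlap N z w ∧ r) true P

admissible : (N n : ℕ) → List (Vec ℕ n) → List (Vec ℕ n)
admissible N n P = filter (λ z → T? (addable N P z)) (grid N n)

sumℚ : List ℚ → ℚ
sumℚ = foldr _+_ (+ 0 / 1)

-- Expected final size of the sequential random packing process started
-- from packing P, with a fuel bound on the number of further steps.
-- If no cube can be added, the value is the size of P; otherwise it is
-- the uniform average over admissible cubes z of the value from z ∷ P.
expFrom : (N n fuel : ℕ) → List (Vec ℕ n) → ℚ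
expFrom N n zero       P = + length P / 1
expFrom N n (suc fuel) P with admissible N n P
... | []     = + length P / 1
... | z ∷ zs = sumℚ (map (λ w → expFrom N n fuel (w ∷ P)) (z ∷ zs))
                 * (+ 1 / suc (length zs))

-- E(M_N^C(n)): start from the empty packing.  The fuel (N+1)^n is the
-- total number of cube positions, and each step places a new cube
-- (a cube always overlaps itself for N ≥ 1), so the fuel never runs out
-- before the process terminates.
EM : (N n : ℕ) → ℚ
EM N n = expFrom N n (suc N ℕ.^ n) []

{-# OPTIONS --safe #-}

-- Let ε = 1/(N+1), let k(z) be the number of coordinates of z equal to 0 or N, and let V(P) be the
-- expected final size from the packing P.  Each cube z covers the subcube of {0,1}ⁿ cut out by its
-- k(z) fixed coordinates, and non-overlapping cubes cover disjoint subcubes, so Σ 2^(-k) ≤ 1 over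
-- every packing.  Hence V ≤ 2ⁿ, and a packing with Σ 2^(-k) = 1 is saturated.  A uniform cube has
-- j fixed coordinates with probability O(εʲ), so V(P) is needed only to precision ε^(3-k) when the
-- next cube fixes k coordinates.  Working backwards: two cubes with k = 1, 2 give V = 3 + O(ε);
-- one cube gives V = 1 if k = 0, V = 2 + 2(n-1)ε + O(ε²) if k = 1 and V = 3 + O(ε) if k = 2.  All
-- three values are 1 + k (1 + 2(n-1)ε) up to the allowed error, and E k = 2nε exactly.

module Submission where

open import Defs
open import Data.Nat as ℕ using (ℕ; zero; suc; _≤_; _∸_; _≡ᵇ_)
import Data.Nat.Properties as ℕ
open import Data.Nat.ListAction using (sum)
import Data.Nat.Solver as ℕ-Solver
open import Data.Integer as ℤ using (+_)
import Data.Integer.Properties as ℤ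
open import Data.Bool using (Bool; true; false; T; not; _∧_; _∨_; _xor_; if_then_else_)
open import Data.Bool.Properties using (T?; T-∧; T-∨; xor-comm; ∧-identityʳ)
open import Data.Empty using (⊥-elim)
open import Data.Unit using (tt)
open import Data.Sum using (inj₁; inj₂)
open import Data.Product using (∃; ∃₂; _×_; _,_)
open import Data.List using (List; []; _∷_; map; concatMap; upTo; applyUpTo; filter; foldr; length; _++_; _∷ʳ_)
open import Data.List.Properties using (applyUpTo-∷ʳ; filter-none; length-map)
open import Data.List.Relation.Unary.All as All using (All; []; _∷_)
open import Data.List.Relation.Unary.All.Properties using (all-filter)
open import Data.List.Relation.Unary.AllPairs using (AllPairs; []; _∷_)
open import Data.Vec as Vec using (Vec; []; _∷_; replicate)
open import Data.Vec.Relation.Binary.Pointwise.Inductive using (Pointwise; []; _∷_)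
open import Data.Rational as ℚ using (ℚ; 0ℚ; 1ℚ; _+_; _-_; _*_; _/_; ∣_∣; -_; toℚᵘ; positive; nonNegative)
  renaming (_≤_ to _≤ℚ_; _<_ to _<ℚ_)
open import Data.Rational.Properties
open import Data.Rational.Solver using (module +-*-Solver)
import Data.Rational.Unnormalised as ℚᵘ
import Data.Rational.Unnormalised.Properties as ℚᵘ
open import Algebra.Definitions.RawSemiring +-*-rawSemiring using (_^_)
open import Function.Base using (it; _∘_)
open import Function.Bundles using (Equivalence)
open import Relation.Binary.PropositionalEquality
open import Relation.Nullary using (¬_)
open +-*-Solver using (solve; _:+_; _:*_; _:-_; :-_; _:=_; con)
open ℕ-Solver.+-*-Solver using ()
  renaming (solve to solveℕ; _:+_ to _:+ₙ_; _:*_ to _:*ₙ_; _:=_ to _:=ₙ_; con to conₙ)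

-- Rational arithmetic

ι : ℕ → ℚ
ι m = + m / 1

toℚᵘ-/ : ∀ a d → toℚᵘ (+ a / suc d) ℚᵘ.≃ ℚᵘ.mkℚᵘ (+ a) d
toℚᵘ-/ a d = toℚᵘ-fromℚᵘ (ℚᵘ.mkℚᵘ (+ a) d)

ι-+ : ∀ a b → ι (a ℕ.+ b) ≡ ι a + ι b
ι-+ a b = toℚᵘ-injective (ℚᵘ.≃-trans (toℚᵘ-/ (a ℕ.+ b) 0) (ℚᵘ.≃-trans (ℚᵘ.*≡* eq) (ℚᵘ.≃-sym
  (ℚᵘ.≃-trans (toℚᵘ-homo-+ (ι a) (ι b)) (ℚᵘ.+-cong (toℚᵘ-/ a 0) (toℚᵘ-/ b 0))))))
  where
  eq : + (a ℕ.+ b) ℤ.* + 1 ≡ (+ a ℤ.* + 1 ℤ.+ + b ℤ.* + 1) ℤ.* + 1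
  eq = cong (ℤ._* + 1) (trans (ℤ.pos-+ a b) (cong₂ ℤ._+_ (sym (ℤ.*-identityʳ (+ a))) (sym (ℤ.*-identityʳ (+ b)))))

/-*-ι : ∀ a d .{{_ : ℕ.NonZero d}} → (+ a / d) * ι d ≡ ι a
/-*-ι a (suc d) = toℚᵘ-injective (ℚᵘ.≃-trans (toℚᵘ-homo-* (+ a / suc d) (ι (suc d)))
  (ℚᵘ.≃-trans (ℚᵘ.*-cong (toℚᵘ-/ a d) (toℚᵘ-/ (suc d) 0)) (ℚᵘ.≃-trans (ℚᵘ.*≡* eq) (ℚᵘ.≃-sym (toℚᵘ-/ a 0)))))
  where
  eq : (+ a ℤ.* + suc d) ℤ.* + 1 ≡ + a ℤ.* (+ suc (d ℕ.* 1))
  eq = trans (ℤ.*-identityʳ _) (cong (λ x → + a ℤ.* + suc x) (sym (ℕ.*-identityʳ d)))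

ι-suc : ∀ a → ι (suc a) ≡ 1ℚ + ι a
ι-suc a = ι-+ 1 a

ι-* : ∀ a b → ι (a ℕ.* b) ≡ ι a * ι b
ι-* zero b = sym (*-zeroˡ (ι b))
ι-* (suc a) b = begin
  ι (b ℕ.+ a ℕ.* b) ≡⟨ ι-+ b (a ℕ.* b) ⟩
  ι b + ι (a ℕ.* b) ≡⟨ cong (_+_ (ι b)) (ι-* a b) ⟩
  ι b + ι a * ι b   ≡⟨ solve 2 (λ x y → y :+ x :* y := (con 1ℚ :+ x) :* y) refl (ι a) (ι b) ⟩
  (1ℚ + ι a) * ι b  ≡⟨ cong (_* ι b) (sym (ι-suc a)) ⟩
  ι (suc a) * ι b   ∎
  where open ≡-Reasoning

0≤ι : ∀ a → 0ℚ ≤ℚ ι a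
0≤ι a = nonNegative⁻¹ (ι a) {{normalize-nonNeg a 1}}

ι-mono : ∀ {a b} → a ℕ.≤ b → ι a ≤ℚ ι b
ι-mono {a} {b} a≤b = subst₂ _≤ℚ_ (+-identityʳ (ι a)) (trans (sym (ι-+ a (b ∸ a))) (cong ι (ℕ.m+[n∸m]≡n a≤b)))
  (+-monoʳ-≤ (ι a) (0≤ι (b ∸ a)))

/≡ι* : ∀ a d .{{_ : ℕ.NonZero d}} → + a / d ≡ ι a * (+ 1 / d)
/≡ι* a d = begin
  x                ≡⟨ sym (*-identityʳ x) ⟩
  x * 1ℚ           ≡⟨ cong (x *_) (sym (/-*-ι 1 d)) ⟩
  x * (y * ι d)    ≡⟨ solve 3 (λ x y d → x :* (y :* d) := (x :* d) :* y) refl x y (ι d) ⟩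
  (x * ι d) * y    ≡⟨ cong (_* y) (/-*-ι a d) ⟩
  ι a * y          ∎
  where
  open ≡-Reasoning
  x = + a / d
  y = + 1 / d

1/-^ : ∀ d j .{{_ : ℕ.NonZero d}} .{{_ : ℕ.NonZero (d ℕ.^ j)}} → + 1 / (d ℕ.^ j) ≡ (+ 1 / d) ^ j
1/-^ d zero = refl
1/-^ d (suc j) = begin
  x                     ≡⟨ sym (*-identityʳ x) ⟩
  x * 1ℚ                ≡⟨ cong (x *_) (sym (cong₂ _*_ (/-*-ι 1 d) (/-*-ι 1 (d ℕ.^ j) {{nz′}}))) ⟩
  x * ((y * ι d) * (z * ι (d ℕ.^ j)))
    ≡⟨ solve 5 (λ x y z d e → x :* ((y :* d) :* (z :* e)) := (x :* (d :* e)) :* (y :* z)) refl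
         x y z (ι d) (ι (d ℕ.^ j)) ⟩
  (x * (ι d * ι (d ℕ.^ j))) * (y * z)    ≡⟨ cong (λ t → (x * t) * (y * z)) (sym (ι-* d (d ℕ.^ j))) ⟩
  (x * ι (d ℕ.^ suc j)) * (y * z)    ≡⟨ cong (_* (y * z)) (/-*-ι 1 (d ℕ.^ suc j)) ⟩
  1ℚ * (y * z)          ≡⟨ *-identityˡ _ ⟩
  y * z          ≡⟨ cong (y *_) (1/-^ d j {{it}} {{nz′}}) ⟩
  y * y ^ j          ∎
  where
  open ≡-Reasoning
  nz′ : ℕ.NonZero (d ℕ.^ j)
  nz′ = ℕ.m^n≢0 d j
  x = + 1 / (d ℕ.^ suc j)
  y = + 1 / d
  z = (+ 1 / (d ℕ.^ j)) {{nz′}}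

*-monoˡ : ∀ {r p q} → 0ℚ ≤ℚ r → p ≤ℚ q → r * p ≤ℚ r * q
*-monoˡ {r} 0≤r = *-monoˡ-≤-nonNeg r {{nonNegative 0≤r}}

*-monoʳ : ∀ {r p q} → 0ℚ ≤ℚ r → p ≤ℚ q → p * r ≤ℚ q * r
*-monoʳ {r} 0≤r = *-monoʳ-≤-nonNeg r {{nonNegative 0≤r}}

0≤* : ∀ {p q} → 0ℚ ≤ℚ p → 0ℚ ≤ℚ q → 0ℚ ≤ℚ p * q
0≤* {p} {q} 0≤p 0≤q = subst (_≤ℚ p * q) (*-zeroʳ p) (*-monoˡ 0≤p 0≤q)

0≤+ : ∀ {p q} → 0ℚ ≤ℚ p → 0ℚ ≤ℚ q → 0ℚ ≤ℚ p + q
0≤+ 0≤p 0≤q = +-mono-≤ 0≤p 0≤q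

0≤^ : ∀ {p} j → 0ℚ ≤ℚ p → 0ℚ ≤ℚ p ^ j
0≤^ zero    _   = 0≤ι 1
0≤^ (suc j) 0≤p = 0≤* 0≤p (0≤^ j 0≤p)

^-pos : ∀ {p} j → 0ℚ <ℚ p → 0ℚ <ℚ p ^ j
^-pos     zero    _   = positive⁻¹ 1ℚ
^-pos {p} (suc j) 0<p = positive⁻¹ (p * p ^ j)
  {{pos*pos⇒pos p {{positive 0<p}} (p ^ j) {{positive (^-pos j 0<p)}}}}

p≤q+p : ∀ {p q} → 0ℚ ≤ℚ q → p ≤ℚ q + p
p≤q+p {p} {q} 0≤q = subst (_≤ℚ q + p) (+-identityˡ p) (+-monoˡ-≤ p 0≤q)

p≤p+q : ∀ {p q} → 0ℚ ≤ℚ q → p ≤ℚ p + q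
p≤p+q {p} {q} 0≤q = subst (_≤ℚ p + q) (+-identityʳ p) (+-monoʳ-≤ p 0≤q)

*-cancelʳ : ∀ {p q r} → 0ℚ <ℚ r → p * r ≤ℚ q * r → p ≤ℚ q
*-cancelʳ {r = r} 0<r = *-cancelʳ-≤-pos r {{positive 0<r}}

∣-∣-*ʳ : ∀ p q {r} → 0ℚ ≤ℚ r → ∣ p * r - q * r ∣ ≡ ∣ p - q ∣ * r
∣-∣-*ʳ p q {r} 0≤r = trans (cong ∣_∣ (solve 3 (λ p q r → p :* r :- q :* r := (p :- q) :* r) refl p q r))
  (trans (∣p*q∣≡∣p∣*∣q∣ (p - q) r) (cong (_*_ (∣ p - q ∣)) (0≤p⇒∣p∣≡p 0≤r)))

∣-∣-triangle : ∀ p q r → ∣ p - r ∣ ≤ℚ ∣ p - q ∣ + ∣ q - r ∣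
∣-∣-triangle p q r = subst (λ x → ∣ x ∣ ≤ℚ ∣ p - q ∣ + ∣ q - r ∣)
  (solve 3 (λ p q r → (p :- q) :+ (q :- r) := p :- r) refl p q r) (∣p+q∣≤∣p∣+∣q∣ (p - q) (q - r))

∣p-p∣ : ∀ {p q} → p ≡ q → ∣ p - q ∣ ≡ 0ℚ
∣p-p∣ {p} refl = cong ∣_∣ (+-inverseʳ p)

-- The recursion controls `v` only after multiplication by a weight `a`, the mass or number of
-- admissible cubes. Any positive lower bound `r` for that weight can be divided out.
∣-∣-divide : ∀ v g {a r s} → 0ℚ <ℚ r → r ≤ℚ a → ∣ v * a - g * a ∣ ≤ℚ s * r → ∣ v - g ∣ ≤ℚ s
∣-∣-divide v g {a} {r} {s} 0<r r≤a h = *-cancelʳ 0<r (begin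
  ∣ v - g ∣ * r          ≤⟨ *-monoˡ (0≤∣p∣ (v - g)) r≤a ⟩
  ∣ v - g ∣ * a          ≡⟨ sym (∣-∣-*ʳ v g (≤-trans (<⇒≤ 0<r) r≤a)) ⟩
  ∣ v * a - g * a ∣      ≤⟨ h ⟩
  s * r                  ∎)
  where open ≤-Reasoning

-- Finite sums and indicator weights

∑ : ∀ {A : Set} → (A → ℚ) → List A → ℚ
∑ f xs = sumℚ (map f xs)

∑-++ : ∀ {A : Set} (f : A → ℚ) xs ys → ∑ f (xs ++ ys) ≡ ∑ f xs + ∑ f ys
∑-++ f []       ys = sym (+-identityˡ _)
∑-++ f (x ∷ xs) ys = trans (cong (_+_ (f x)) (∑-++ f xs ys)) (sym (+-assoc (f x) _ _))

∑-cong : ∀ {A : Set} {f g : A → ℚ} → (∀ x → f x ≡ g x) → ∀ xs → ∑ f xs ≡ ∑ g xs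
∑-cong h []       = refl
∑-cong h (x ∷ xs) = cong₂ _+_ (h x) (∑-cong h xs)

∑-const : ∀ {A : Set} (c : ℚ) (xs : List A) → ∑ (λ _ → c) xs ≡ ι (length xs) * c
∑-const c []       = sym (*-zeroˡ c)
∑-const c (x ∷ xs) = begin
  c + ∑ (λ _ → c) xs        ≡⟨ cong (_+_ c) (∑-const c xs) ⟩
  c + ι (length xs) * c     ≡⟨ solve 2 (λ c l → c :+ l :* c := (con 1ℚ :+ l) :* c) refl c (ι (length xs)) ⟩
  (1ℚ + ι (length xs)) * c  ≡⟨ cong (_* c) (sym (ι-suc (length xs))) ⟩
  ι (suc (length xs)) * c   ∎
  where open ≡-Reasoning

∑-map : ∀ {A B : Set} (f : B → ℚ) (g : A → B) xs → ∑ f (map g xs) ≡ ∑ (f ∘ g) xs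
∑-map f g []       = refl
∑-map f g (x ∷ xs) = cong (_+_ (f (g x))) (∑-map f g xs)

∑-concatMap : ∀ {A B : Set} (f : B → ℚ) (g : A → List B) xs → ∑ f (concatMap g xs) ≡ ∑ (λ x → ∑ f (g x)) xs
∑-concatMap f g []       = refl
∑-concatMap f g (x ∷ xs) = trans (∑-++ f (g x) _) (cong (_+_ (∑ f (g x))) (∑-concatMap f g xs))

-- An indicator weight, so that a sum over a filtered list becomes one over the whole list.
only : Bool → ℚ → ℚ
only true  x = x
only false x = 0ℚ

only-≤ : ∀ b {x} → 0ℚ ≤ℚ x → only b x ≤ℚ x
only-≤ true  _   = ≤-refl
only-≤ false 0≤x = 0≤x

only-* : ∀ b c → only b c ≡ c * only b 1ℚ
only-* true  c = sym (*-identityʳ c)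
only-* false c = sym (*-zeroʳ c)

only-nonneg : ∀ b {x} → 0ℚ ≤ℚ x → 0ℚ ≤ℚ only b x
only-nonneg true  0≤x = 0≤x
only-nonneg false _   = ≤-refl

1≤only : ∀ b → T b → 1ℚ ≤ℚ only b 1ℚ
1≤only true _ = ≤-refl

∑-filter : ∀ {A : Set} (b : A → Bool) (f : A → ℚ) xs →
  ∑ f (filter (λ x → T? (b x)) xs) ≡ ∑ (λ x → only (b x) (f x)) xs
∑-filter b f []       = refl
∑-filter b f (x ∷ xs) with b x
... | true  = cong (_+_ (f x)) (∑-filter b f xs)
... | false = trans (∑-filter b f xs) (sym (+-identityˡ _))

∑-applyUpTo : ∀ (f : ℕ → ℚ) (g : ℕ → ℕ) c j → (∀ i → i ℕ.< j → f (g i) ≡ c) → ∑ f (applyUpTo g j) ≡ ι j * c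
∑-applyUpTo f g c zero    h = sym (*-zeroˡ c)
∑-applyUpTo f g c (suc j) h = begin
  f (g 0) + ∑ f (applyUpTo (g ∘ suc) j)
    ≡⟨ cong₂ _+_ (h 0 (ℕ.s≤s ℕ.z≤n)) (∑-applyUpTo f (g ∘ suc) c j (λ i i<j → h (suc i) (ℕ.s≤s i<j))) ⟩
  c + ι j * c     ≡⟨ solve 2 (λ c l → c :+ l :* c := (con 1ℚ :+ l) :* c) refl c (ι j) ⟩
  (1ℚ + ι j) * c  ≡⟨ cong (_* c) (sym (ι-suc j)) ⟩
  ι (suc j) * c   ∎
  where open ≡-Reasoning

∑-∣-∣ : ∀ {A : Set} (f g e : A → ℚ) xs → All (λ x → ∣ f x - g x ∣ ≤ℚ e x) xs → ∣ ∑ f xs - ∑ g xs ∣ ≤ℚ ∑ e xs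
∑-∣-∣ f g e []       []       = ≤-refl
∑-∣-∣ f g e (x ∷ xs) (p ∷ ps) = begin
  ∣ (f x + ∑ f xs) - (g x + ∑ g xs) ∣
    ≡⟨ cong ∣_∣ (solve 4 (λ a b c d → (a :+ b) :- (c :+ d) := (a :- c) :+ (b :- d)) refl
         (f x) (∑ f xs) (g x) (∑ g xs)) ⟩
  ∣ (f x - g x) + (∑ f xs - ∑ g xs) ∣     ≤⟨ ∣p+q∣≤∣p∣+∣q∣ (f x - g x) (∑ f xs - ∑ g xs) ⟩
  ∣ f x - g x ∣ + ∣ ∑ f xs - ∑ g xs ∣     ≤⟨ +-mono-≤ p (∑-∣-∣ f g e xs ps) ⟩
  e x + ∑ e xs ∎
  where open ≤-Reasoning

-- Patterns and their volume

-- fixed false, fixed true and free stand for the values 0, 1 and strictly between: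
-- a free coordinate separates its cube from no other.
data Coord : Set where
  fixed : Bool → Coord
  free  : Coord

Pattern : ℕ → Set
Pattern = Vec Coord

sepC : Coord → Coord → Bool
sepC (fixed a) (fixed b) = a xor b
sepC (fixed _) free      = false
sepC free      _         = false

sep : ∀ {n} → Pattern n → Pattern n → Bool
sep []       []       = false
sep (a ∷ as) (b ∷ bs) = sepC a b ∨ sep as bs

fits : ∀ {n} → List (Pattern n) → Pattern n → Bool
fits Q z = foldr (λ w r → sep z w ∧ r) true Q

#fixed : ∀ {n} → Pattern n → ℕ
#fixed []            = 0
#fixed (fixed _ ∷ z) = suc (#fixed z)
#fixed (free    ∷ z) = #fixed z

-- The number of vertices of `{0,1}ⁿ` in the covered subcube, which keeps the volume a natural
-- number.
vol : ∀ {n} → Pattern n → ℕ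
vol []            = 1
vol (fixed _ ∷ z) = vol z
vol (free    ∷ z) = 2 ℕ.* vol z

vol>0 : ∀ {n} (z : Pattern n) → 1 ℕ.≤ vol z
vol>0 []            = ℕ.≤-refl
vol>0 (fixed _ ∷ z) = vol>0 z
vol>0 (free    ∷ z) = ℕ.≤-trans (vol>0 z) (ℕ.m≤m+n _ _)

vol*2^#fixed : ∀ {n} (z : Pattern n) → vol z ℕ.* 2 ℕ.^ #fixed z ≡ 2 ℕ.^ n
vol*2^#fixed []            = refl
vol*2^#fixed (fixed _ ∷ z) = trans
  (solveℕ 2 (λ v k → v :*ₙ (conₙ 2 :*ₙ k) :=ₙ conₙ 2 :*ₙ (v :*ₙ k)) refl (vol z) (2 ℕ.^ #fixed z))
  (cong (2 ℕ.*_) (vol*2^#fixed z))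
vol*2^#fixed (free    ∷ z) =
  trans (ℕ.*-assoc 2 (vol z) _) (cong (2 ℕ.*_) (vol*2^#fixed z))

#fixed≤ : ∀ {n} (z : Pattern n) → #fixed z ℕ.≤ n
#fixed≤ []            = ℕ.z≤n
#fixed≤ (fixed _ ∷ z) = ℕ.s≤s (#fixed≤ z)
#fixed≤ (free    ∷ z) = ℕ.m≤n⇒m≤1+n (#fixed≤ z)

-- A proof points at one separating coordinate, which is what the inductions below match on; `sep`
-- is the Boolean counterpart.
data _#_ : ∀ {n} → Pattern n → Pattern n → Set where
  here  : ∀ {n b c} {u z : Pattern n} → T (b xor c) → (fixed b ∷ u) # (fixed c ∷ z)
  there : ∀ {n a c} {u z : Pattern n} → u # z → (a ∷ u) # (c ∷ z)

sep⇒# : ∀ {n} (u z : Pattern n) → T (sep u z) → u # z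
sep⇒# [] [] ()
sep⇒# (fixed a ∷ u) (fixed b ∷ z) h with Equivalence.to (T-∨ {a xor b}) h
... | inj₁ p = here p
... | inj₂ p = there (sep⇒# u z p)
sep⇒# (fixed _ ∷ u) (free ∷ z) h = there (sep⇒# u z h)
sep⇒# (free ∷ u)    (_ ∷ z)    h = there (sep⇒# u z h)

#⇒sep : ∀ {n} {u z : Pattern n} → u # z → T (sep u z)
#⇒sep (here p)                    = Equivalence.from T-∨ (inj₁ p)
#⇒sep (there {a = a} {c = c} p) = Equivalence.from (T-∨ {sepC a c}) (inj₂ (#⇒sep p))

#-sym : ∀ {n} {u z : Pattern n} → u # z → z # u
#-sym (here {b = b} {c} p) = here (subst T (xor-comm b c) p)
#-sym (there p) = there (#-sym p)

-- A separating coordinate is fixed in both patterns. This excludes a next cube without fixed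
-- coordinates once the packing is nonempty.
#⇒fixedˡ : ∀ {n} {u z : Pattern n} → u # z → 1 ℕ.≤ #fixed u
#⇒fixedˡ (here _)              = ℕ.s≤s ℕ.z≤n
#⇒fixedˡ (there {a = fixed _} p) = ℕ.s≤s ℕ.z≤n
#⇒fixedˡ (there {a = free} p)    = #⇒fixedˡ p

Separated : ∀ {n} → List (Pattern n) → Set
Separated = AllPairs _#_

volume : ∀ {n} → List (Pattern n) → ℕ
volume = sum ∘ map vol

fits⇒All : ∀ {n} (Q : List (Pattern n)) z → T (fits Q z) → All (z #_) Q
fits⇒All []      z _ = []
fits⇒All (w ∷ Q) z p with Equivalence.to (T-∧ {sep z w}) p
... | q , r = sep⇒# z w q ∷ fits⇒All Q z r

All⇒fits : ∀ {n} (Q : List (Pattern n)) z → All (z #_) Q → T (fits Q z)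
All⇒fits []      z []       = tt
All⇒fits (w ∷ Q) z (p ∷ ps) = Equivalence.from T-∧ (#⇒sep p , All⇒fits Q z ps)

-- The covered subcubes of {0,1}ⁿ⁺¹ cut down to the facet with first coordinate b.
face : ∀ {n} → Bool → List (Pattern (suc n)) → List (Pattern n)
face b []                      = []
face b ((free        ∷ z) ∷ Q) = z ∷ face b Q
face true  ((fixed true  ∷ z) ∷ Q) = z ∷ face true Q
face true  ((fixed false ∷ z) ∷ Q) = face true Q
face false ((fixed true  ∷ z) ∷ Q) = face false Q
face false ((fixed false ∷ z) ∷ Q) = z ∷ face false Q

-- A free first coordinate puts a pattern in both facets, matching its factor 2 in `vol`; a fixed
-- one puts it in exactly one.
volume-faces : ∀ {n} (Q : List (Pattern (suc n))) →
  volume Q ≡ volume (face false Q) ℕ.+ volume (face true Q)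
volume-faces []                        = refl
volume-faces ((fixed true ∷ z) ∷ Q)    = trans (cong (vol z ℕ.+_) (volume-faces Q))
  (solveℕ 3 (λ v a b → v :+ₙ (a :+ₙ b) :=ₙ a :+ₙ (v :+ₙ b)) refl
    (vol z) (volume (face false Q)) (volume (face true Q)))
volume-faces ((fixed false ∷ z) ∷ Q)   = trans (cong (vol z ℕ.+_) (volume-faces Q))
  (sym (ℕ.+-assoc (vol z) _ _))
volume-faces ((free ∷ z) ∷ Q)          = trans (cong (2 ℕ.* vol z ℕ.+_) (volume-faces Q))
  (solveℕ 3 (λ v a b → conₙ 2 :*ₙ v :+ₙ (a :+ₙ b) :=ₙ (v :+ₙ a) :+ₙ (v :+ₙ b)) refl
    (vol z) (volume (face false Q)) (volume (face true Q)))

data _Meets_ : Coord → Bool → Set where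
  fixed : ∀ {b} → fixed b Meets b
  free  : ∀ {b} → free Meets b

-- The first coordinate cannot separate two patterns that meet the same facet: if both are fixed
-- there, both values are `b`.
#-tail : ∀ {n a c b} {z w : Pattern n} → a Meets b → c Meets b → (a ∷ z) # (c ∷ w) → z # w
#-tail {b = true}  fixed fixed (here ())
#-tail {b = false} fixed fixed (here ())
#-tail             _     _     (there p) = p

face-All : ∀ {n a} {z : Pattern n} b Q → a Meets b →
  All ((a ∷ z) #_) Q → All (z #_) (face b Q)
face-All b [] h [] = []
face-All b ((free ∷ w) ∷ Q) h (p ∷ ps) = #-tail h free p ∷ face-All b Q h ps
face-All true ((fixed true ∷ w) ∷ Q) h (p ∷ ps) = #-tail h fixed p ∷ face-All true Q h ps
face-All true ((fixed false ∷ w) ∷ Q) h (p ∷ ps) = face-All true Q h ps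
face-All false ((fixed true ∷ w) ∷ Q) h (p ∷ ps) = face-All false Q h ps
face-All false ((fixed false ∷ w) ∷ Q) h (p ∷ ps) = #-tail h fixed p ∷ face-All false Q h ps

face-Separated : ∀ {n} b (Q : List (Pattern (suc n))) → Separated Q → Separated (face b Q)
face-Separated b [] [] = []
face-Separated b ((free ∷ z) ∷ Q) (p ∷ s) = face-All b Q free p ∷ face-Separated b Q s
face-Separated true ((fixed true ∷ z) ∷ Q) (p ∷ s) = face-All true Q fixed p ∷ face-Separated true Q s
face-Separated true ((fixed false ∷ z) ∷ Q) (p ∷ s) = face-Separated true Q s
face-Separated false ((fixed true ∷ z) ∷ Q) (p ∷ s) = face-Separated false Q s
face-Separated false ((fixed false ∷ z) ∷ Q) (p ∷ s) = face-All false Q fixed p ∷ face-Separated false Q s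

-- A Kraft inequality, by induction on the dimension: each facet carries a separated family of its
-- own, and the two bounds add up. In dimension 0 two patterns cannot be separated.
kraft : ∀ {n} (Q : List (Pattern n)) → Separated Q → volume Q ℕ.≤ 2 ℕ.^ n
kraft {zero} [] s = ℕ.z≤n
kraft {zero} ([] ∷ []) s = ℕ.≤-refl
kraft {zero} ([] ∷ ([] ∷ _)) ((() ∷ _) ∷ _)
kraft {suc n} Q s = begin
  volume Q                                         ≡⟨ volume-faces Q ⟩
  volume (face false Q) ℕ.+ volume (face true Q)
    ≤⟨ ℕ.+-mono-≤ (kraft _ (face-Separated false Q s)) (kraft _ (face-Separated true Q s)) ⟩
  2 ℕ.^ n ℕ.+ 2 ℕ.^ n                              ≡⟨ cong (2 ℕ.^ n ℕ.+_) (sym (ℕ.+-identityʳ _)) ⟩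
  2 ℕ.^ suc n ∎
  where open ℕ.≤-Reasoning

length≤volume : ∀ {n} (Q : List (Pattern n)) → length Q ℕ.≤ volume Q
length≤volume []      = ℕ.z≤n
length≤volume (z ∷ Q) = ℕ.+-mono-≤ (vol>0 z) (length≤volume Q)

-- Refinement and patterns in the gaps

data _RefinesC_ : Coord → Coord → Set where
  free  : ∀ {a} → a RefinesC free
  fixed : ∀ {b} → fixed b RefinesC fixed b

_Refines_ : ∀ {n} → Pattern n → Pattern n → Set
_Refines_ = Pointwise _RefinesC_

-- The separating coordinate is fixed in `p`, and a refinement has the same value there.
Refines-# : ∀ {n} {u p z : Pattern n} → u Refines p → p # z → u # z
Refines-# (fixed ∷ _) (here h)  = here h
Refines-# (_ ∷ r)     (there h) = there (Refines-# r h)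

#fixed-replicate : ∀ n → #fixed (replicate n free) ≡ 0
#fixed-replicate zero = refl
#fixed-replicate (suc n) = #fixed-replicate n

not-xor : ∀ b → T (not b xor b)
not-xor true = tt
not-xor false = tt

-- Invert one fixed coordinate of `z` and free all others. With a single fixed coordinate, `p` shows
-- that the mass left beside `z` is at least `ε`.
partner : ∀ {n} (z : Pattern n) → 1 ℕ.≤ #fixed z → ∃ λ p → #fixed p ≡ 1 × p # z
partner {suc n} (fixed b ∷ z) _ =
  fixed (not b) ∷ replicate n free , cong suc (#fixed-replicate n) , here (not-xor b)
partner (free ∷ z) h with partner z h
... | p , e , s = free ∷ p , e , there s

partner₂-fixed : ∀ {n} b (z w : Pattern n) a → 1 ℕ.≤ #fixed w →
  ∃ λ p → #fixed p ≡ 2 × p # (fixed b ∷ z) × p # (a ∷ w)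
partner₂-fixed b z w a h with partner w h
... | p , e , s = fixed (not b) ∷ p , cong suc e , here (not-xor b) , there s

-- Invert a fixed coordinate of `u` and one of `z` at a different position. Such positions exist:
-- separation gives a position fixed in both, and the total 3 gives one more fixed entry. The gap
-- beside `u` and `z` thus has mass at least `ε ^ 2`.
partner₂ : ∀ {n} (u z : Pattern n) → #fixed u ℕ.+ #fixed z ≡ 3 → u # z →
  ∃ λ p → #fixed p ≡ 2 × p # u × p # z
partner₂ (free ∷ u) (free ∷ z) k (there s) with partner₂ u z k s
... | p , e , s₁ , s₂ = free ∷ p , e , there s₁ , there s₂
partner₂ (free ∷ u) (fixed b ∷ z) k (there s) with partner₂-fixed b z u free (#⇒fixedˡ s)
... | p , e , s₁ , s₂ = p , e , s₂ , s₁
partner₂ (fixed b ∷ u) (free ∷ z) k (there s) = partner₂-fixed b u z free (#⇒fixedˡ (#-sym s))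
partner₂ (fixed b ∷ u) (fixed c ∷ z) k s with #fixed u in eu
-- With no other fixed coordinate in `u`, the total forces exactly one in the tail of `z`.
... | zero = partner₂-fixed b u z (fixed c)
  (ℕ.≤-reflexive (sym (ℕ.suc-injective (ℕ.suc-injective k))))
... | suc _ with partner₂-fixed c z u (fixed b) (subst (1 ℕ.≤_) (sym eu) (ℕ.s≤s ℕ.z≤n))
... | p , e , s₁ , s₂ = p , e , s₂ , s₁

-- Volumes in quarters

-- The volume in units of 2ⁿ⁻², clear of division: share p means volume p · 2ⁿ / 4.
Share : ∀ {n} → Pattern n → ℕ → Set
Share {n} z p = vol z ℕ.* 4 ≡ p ℕ.* 2 ℕ.^ n

share₁ : ∀ {n} (z : Pattern n) → #fixed z ≡ 1 → Share z 2
share₁ {n} z e = begin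
  vol z ℕ.* 4                       ≡⟨ solveℕ 1 (λ v → v :*ₙ conₙ 4 :=ₙ conₙ 2 :*ₙ (v :*ₙ conₙ 2)) refl (vol z) ⟩
  2 ℕ.* (vol z ℕ.* 2 ℕ.^ 1)         ≡⟨ cong (λ j → 2 ℕ.* (vol z ℕ.* 2 ℕ.^ j)) (sym e) ⟩
  2 ℕ.* (vol z ℕ.* 2 ℕ.^ #fixed z)  ≡⟨ cong (2 ℕ.*_) (vol*2^#fixed z) ⟩
  2 ℕ.* 2 ℕ.^ n                     ∎
  where
  open ≡-Reasoning

share₂ : ∀ {n} (z : Pattern n) → #fixed z ≡ 2 → Share z 1
share₂ {n} z e = trans (cong (λ j → vol z ℕ.* 2 ℕ.^ j) (sym e)) (trans (vol*2^#fixed z) (sym (ℕ.*-identityˡ _)))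

-- Separation needs a fixed coordinate on each side, so the counts are 1 and 2: a half and a
-- quarter, leaving one quarter.
shares-3 : ∀ {n} (u z : Pattern n) → #fixed u ℕ.+ #fixed z ≡ 3 → u # z →
  ∃₂ λ p q → Share u p × Share z q × p ℕ.+ q ≡ 3
shares-3 u z e s with #fixed u in eu | #fixed z in ez
... | 0 | _ with () ← subst (1 ℕ.≤_) eu (#⇒fixedˡ s)
... | 1 | 2 = 2 , 1 , share₁ u eu , share₂ z ez , refl
... | 2 | 1 = 1 , 2 , share₂ u eu , share₁ z ez , refl
... | 3 | 0 with () ← subst (1 ℕ.≤_) ez (#⇒fixedˡ (#-sym s))
shares-3 u z () s | suc (suc (suc (suc _))) | _
shares-3 u z () s | 1 | suc (suc (suc _))
shares-3 u z () s | 2 | suc (suc _)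

volume₂ : ∀ {n} {u z : Pattern n} {p q} → Share u p → Share z q →
  volume (u ∷ z ∷ []) ℕ.* 4 ≡ (p ℕ.+ q) ℕ.* 2 ℕ.^ n
volume₂ {n} {u} {z} {p} {q} a b = begin
  (vol u ℕ.+ (vol z ℕ.+ 0)) ℕ.* 4     ≡⟨ cong (λ x → (vol u ℕ.+ x) ℕ.* 4) (ℕ.+-identityʳ (vol z)) ⟩
  (vol u ℕ.+ vol z) ℕ.* 4             ≡⟨ ℕ.*-distribʳ-+ 4 (vol u) (vol z) ⟩
  vol u ℕ.* 4 ℕ.+ vol z ℕ.* 4         ≡⟨ cong₂ ℕ._+_ a b ⟩
  p ℕ.* 2 ℕ.^ n ℕ.+ q ℕ.* 2 ℕ.^ n     ≡⟨ sym (ℕ.*-distribʳ-+ (2 ℕ.^ n) p q) ⟩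
  (p ℕ.+ q) ℕ.* 2 ℕ.^ n               ∎
  where open ≡-Reasoning

volume₃ : ∀ {n} {v u z : Pattern n} {r p q} → Share v r → Share u p → Share z q →
  volume (v ∷ u ∷ z ∷ []) ℕ.* 4 ≡ (r ℕ.+ (p ℕ.+ q)) ℕ.* 2 ℕ.^ n
volume₃ {n} {v} {u} {z} {r} {p} {q} c a b = begin
  (vol v ℕ.+ volume (u ∷ z ∷ [])) ℕ.* 4   ≡⟨ ℕ.*-distribʳ-+ 4 (vol v) _ ⟩
  vol v ℕ.* 4 ℕ.+ volume (u ∷ z ∷ []) ℕ.* 4 ≡⟨ cong₂ ℕ._+_ c (volume₂ {u = u} {z} {p} {q} a b) ⟩
  r ℕ.* 2 ℕ.^ n ℕ.+ (p ℕ.+ q) ℕ.* 2 ℕ.^ n   ≡⟨ sym (ℕ.*-distribʳ-+ (2 ℕ.^ n) r (p ℕ.+ q)) ⟩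
  (r ℕ.+ (p ℕ.+ q)) ℕ.* 2 ℕ.^ n             ∎
  where open ≡-Reasoning

four-shares : ∀ {n} (Q : List (Pattern n)) → volume Q ℕ.* 4 ≡ 4 ℕ.* 2 ℕ.^ n → 2 ℕ.^ n ℕ.≤ volume Q
four-shares {n} Q e = ℕ.*-cancelʳ-≤ _ _ 4 (ℕ.≤-reflexive (trans (ℕ.*-comm (2 ℕ.^ n) 4) (sym e)))

-- Five quarters contradict `kraft`. This excludes a cube with one fixed coordinate, a half, on top
-- of three quarters.
overfull : ∀ {n} (Q : List (Pattern n)) → Separated Q → ¬ (volume Q ℕ.* 4 ≡ 5 ℕ.* 2 ℕ.^ n)
overfull {n} Q s e = ℕ.<-irrefl refl (ℕ.*-cancelʳ-≤ 5 4 (2 ℕ.^ n) {{ℕ.m^n≢0 2 n}}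
  (subst₂ ℕ._≤_ e (ℕ.*-comm (2 ℕ.^ n) 4) (ℕ.*-monoˡ-≤ 4 (kraft Q s))))

-- Averages over patterns

module Mean (ε : ℚ) (0≤ε : 0ℚ ≤ℚ ε) (2ε≤1 : ε + ε ≤ℚ 1ℚ) where

  -- The probability that a uniform coordinate is free.
  δ : ℚ
  δ = 1ℚ - (ε + ε)

  0≤δ : 0ℚ ≤ℚ δ
  0≤δ = subst (_≤ℚ δ) (+-inverseʳ (ε + ε)) (+-monoˡ-≤ (- (ε + ε)) 2ε≤1)

  δ≤1 : δ ≤ℚ 1ℚ
  δ≤1 = subst (δ ≤ℚ_) (solve 1 (λ e → (con 1ℚ :- e) :+ e := con 1ℚ) refl (ε + ε)) (p≤p+q (0≤+ 0≤ε 0≤ε))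

  -- ε = 1/(N+1) is the probability that a uniform coordinate is 0, and also that it is N.
  𝔼 : ∀ n → (Pattern n → ℚ) → ℚ
  𝔼 zero    f = f []
  𝔼 (suc n) f = ε * (𝔼 n (f ∘ (fixed false ∷_)) + 𝔼 n (f ∘ (fixed true ∷_))) + δ * 𝔼 n (f ∘ (free ∷_))

  𝔼-cong : ∀ n {f g : Pattern n → ℚ} → (∀ z → f z ≡ g z) → 𝔼 n f ≡ 𝔼 n g
  𝔼-cong zero    h = h []
  𝔼-cong (suc n) h = cong₂ _+_
    (cong (_*_ ε) (cong₂ _+_ (𝔼-cong n (h ∘ _)) (𝔼-cong n (h ∘ _)))) (cong (_*_ δ) (𝔼-cong n (h ∘ _)))

  𝔼-mono : ∀ n {f g : Pattern n → ℚ} → (∀ z → f z ≤ℚ g z) → 𝔼 n f ≤ℚ 𝔼 n g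
  𝔼-mono zero    h = h []
  𝔼-mono (suc n) h = +-mono-≤
    (*-monoˡ 0≤ε (+-mono-≤ (𝔼-mono n (h ∘ _)) (𝔼-mono n (h ∘ _)))) (*-monoˡ 0≤δ (𝔼-mono n (h ∘ _)))

  𝔼-const : ∀ n c → 𝔼 n (λ _ → c) ≡ c
  𝔼-const zero    c = refl
  𝔼-const (suc n) c rewrite 𝔼-const n c =
    solve 2 (λ e c → e :* (c :+ c) :+ (con 1ℚ :- (e :+ e)) :* c := c) refl ε c

  𝔼-* : ∀ n c (f : Pattern n → ℚ) → 𝔼 n (λ z → c * f z) ≡ c * 𝔼 n f
  𝔼-* zero    c f = refl
  𝔼-* (suc n) c f rewrite 𝔼-* n c (f ∘ (fixed false ∷_)) | 𝔼-* n c (f ∘ (fixed true ∷_)) | 𝔼-* n c (f ∘ (free ∷_)) =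
    solve 6 (λ e d c x y z → e :* (c :* x :+ c :* y) :+ d :* (c :* z) := c :* (e :* (x :+ y) :+ d :* z)) refl
      ε δ c (𝔼 n (f ∘ (fixed false ∷_))) (𝔼 n (f ∘ (fixed true ∷_))) (𝔼 n (f ∘ (free ∷_)))

  𝔼-nonneg : ∀ n {f : Pattern n → ℚ} → (∀ z → 0ℚ ≤ℚ f z) → 0ℚ ≤ℚ 𝔼 n f
  𝔼-nonneg n {f} h = subst (_≤ℚ 𝔼 n f) (𝔼-const n 0ℚ) (𝔼-mono n h)

  -- Having j fixed coordinates costs εʲ, so an error of ε^(m - j) there averages to O(εᵐ).
  𝔼-tail : ∀ n m → 𝔼 n (λ z → ε ^ (m ∸ #fixed z)) ≤ℚ ι (3 ℕ.^ n) * ε ^ m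
  𝔼-tail zero    m       = ≤-reflexive (sym (*-identityˡ (ε ^ m)))
  𝔼-tail (suc n) zero    = begin
    𝔼 (suc n) (λ z → ε ^ (0 ∸ #fixed z)) ≡⟨ 𝔼-cong (suc n) (λ z → cong (ε ^_) (ℕ.0∸n≡0 (#fixed z))) ⟩
    𝔼 (suc n) (λ z → 1ℚ)                 ≡⟨ 𝔼-const (suc n) 1ℚ ⟩
    1ℚ                           ≤⟨ ι-mono (ℕ.m^n>0 3 (suc n)) ⟩
    ι (3 ℕ.^ suc n)              ≡⟨ sym (*-identityʳ _) ⟩
    ι (3 ℕ.^ suc n) * 1ℚ         ∎
    where open ≤-Reasoning
  𝔼-tail (suc n) (suc m) = begin
    ε * (x + x) + δ * y
      -- Each of the three values of the first coordinate contributes at most `K * ε ^ suc m`: a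
      -- fixed value lowers the exponent by one but brings a weight `ε`, and a free one has weight
      -- `δ ≤ 1`. Hence the power of 3.
      ≤⟨ +-mono-≤ (*-monoˡ 0≤ε (+-mono-≤ (𝔼-tail n m) (𝔼-tail n m)))
           (≤-trans (*-monoʳ (𝔼-nonneg n (λ z → 0≤^ (suc m ∸ #fixed z) 0≤ε)) δ≤1)
             (*-monoˡ (0≤ι 1) (𝔼-tail n (suc m)))) ⟩
    ε * (K * ε ^ m + K * ε ^ m) + 1ℚ * (K * (ε * ε ^ m))
      ≡⟨ solve 3 (λ e k p → e :* (k :* p :+ k :* p) :+ con 1ℚ :* (k :* (e :* p))
           := (con (ι 3) :* k) :* (e :* p)) refl ε K (ε ^ m) ⟩
    (ι 3 * K) * (ε * ε ^ m) ≡⟨ cong (_* (ε * ε ^ m)) (sym (ι-* 3 (3 ℕ.^ n))) ⟩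
    ι (3 ℕ.^ suc n) * ε ^ suc m ∎
    where
    open ≤-Reasoning
    K = ι (3 ℕ.^ n)
    x = 𝔼 n (λ z → ε ^ (m ∸ #fixed z))
    y = 𝔼 n (λ z → ε ^ (suc m ∸ #fixed z))

  -- Matching a fixed coordinate of `p` has probability `ε` and a free one is unconstrained, so the
  -- refinements of `p` have total weight `ε ^ #fixed p`.
  𝔼-cylinder : ∀ n (p : Pattern n) {f : Pattern n → ℚ} → (∀ z → 0ℚ ≤ℚ f z) →
    (∀ z → z Refines p → 1ℚ ≤ℚ f z) → ε ^ #fixed p ≤ℚ 𝔼 n f
  𝔼-cylinder zero [] 0≤f 1≤f = 1≤f [] []
  𝔼-cylinder (suc n) (fixed b ∷ p) {f} 0≤f 1≤f = begin
    ε * ε ^ #fixed p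
      ≤⟨ *-monoˡ 0≤ε (𝔼-cylinder n p (0≤f ∘ (fixed b ∷_)) (λ z r → 1≤f (fixed b ∷ z) (fixed ∷ r))) ⟩
    ε * 𝔼 n (f ∘ (fixed b ∷_))
      ≤⟨ *-monoˡ 0≤ε (pick b) ⟩
    ε * (𝔼 n (f ∘ (fixed false ∷_)) + 𝔼 n (f ∘ (fixed true ∷_)))
      ≤⟨ p≤p+q (0≤* 0≤δ (𝔼-nonneg n (λ z → 0≤f (free ∷ z)))) ⟩
    𝔼 (suc n) f ∎
    where
    open ≤-Reasoning
    pick : ∀ b → 𝔼 n (f ∘ (fixed b ∷_)) ≤ℚ 𝔼 n (f ∘ (fixed false ∷_)) + 𝔼 n (f ∘ (fixed true ∷_))
    pick false = p≤p+q (𝔼-nonneg n (λ z → 0≤f (fixed true ∷ z)))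
    pick true  = p≤q+p (𝔼-nonneg n (λ z → 0≤f (fixed false ∷ z)))
  𝔼-cylinder (suc n) (free ∷ p) {f} 0≤f 1≤f = begin
    x                         ≡⟨ solve 2 (λ e x → x := e :* (x :+ x) :+ (con 1ℚ :- (e :+ e)) :* x) refl ε x ⟩
    ε * (x + x) + δ * x       ≤⟨ +-mono-≤ (*-monoˡ 0≤ε (+-mono-≤ (rec (fixed false)) (rec (fixed true))))
                                (*-monoˡ 0≤δ (rec free)) ⟩
    𝔼 (suc n) f ∎
    where
    open ≤-Reasoning
    x = ε ^ #fixed p
    rec : ∀ a → x ≤ℚ 𝔼 n (f ∘ (a ∷_))
    rec a = 𝔼-cylinder n p (λ z → 0≤f (a ∷ z)) (λ z r → 1≤f (a ∷ z) (free ∷ r))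

  -- Means of affine functions of the number of fixed coordinates

  k : ∀ {n} → Pattern n → ℚ
  k z = ι (#fixed z)

  affine-suc : ∀ {n} (z : Pattern n) a t → a + ι (suc (#fixed z)) * t ≡ (a + t) + k z * t
  affine-suc z a t = trans (cong (λ i → a + i * t) (ι-suc (#fixed z)))
    (solve 3 (λ a i t → a :+ (con 1ℚ :+ i) :* t := (a :+ t) :+ i :* t) refl a (k z) t)

  -- Each coordinate is fixed with probability `ε + ε`, so `k` has mean `ι n * (ε + ε)`. The
  -- intercept stays general because a fixed first coordinate shifts it by `t`.
  𝔼-affine : ∀ n a t → 𝔼 n (λ z → a + k z * t) ≡ a + (ι n * (ε + ε)) * t
  𝔼-affine zero a t = solve 3 (λ a t e → a :+ con 0ℚ :* t := a :+ (con 0ℚ :* e) :* t) refl a t (ε + ε)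
  𝔼-affine (suc n) a t = begin
    ε * (x + x) + δ * 𝔼 n (λ z → a + k z * t)
      ≡⟨ cong₂ (λ x y → ε * (x + x) + δ * y)
           (trans (𝔼-cong n λ z → affine-suc z a t) (𝔼-affine n (a + t) t))
           (𝔼-affine n a t) ⟩
    ε * (((a + t) + (ι n * (ε + ε)) * t) + ((a + t) + (ι n * (ε + ε)) * t)) + δ * (a + (ι n * (ε + ε)) * t)
      ≡⟨ solve 4 (λ a t e n →
           e :* (((a :+ t) :+ (n :* (e :+ e)) :* t) :+ ((a :+ t) :+ (n :* (e :+ e)) :* t))
             :+ (con 1ℚ :- (e :+ e)) :* (a :+ (n :* (e :+ e)) :* t)
           := a :+ ((con 1ℚ :+ n) :* (e :+ e)) :* t) refl a t ε (ι n) ⟩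
    a + ((1ℚ + ι n) * (ε + ε)) * t
      ≡⟨ cong (λ i → a + (i * (ε + ε)) * t) (sym (ι-suc n)) ⟩
    a + (ι (suc n) * (ε + ε)) * t ∎
    where
    open ≡-Reasoning
    x = 𝔼 n (λ z → a + ι (suc (#fixed z)) * t)

  𝔼-none : ∀ n (z : Pattern n) → #fixed z ≡ 0 → (f : Pattern n → ℚ) →
    𝔼 n (λ u → only (sep u z) (f u)) ≡ 0ℚ
  𝔼-none n z e f = trans (𝔼-cong n λ u → h u (sep u z) refl) (𝔼-const n 0ℚ)
    where
    h : ∀ u b → sep u z ≡ b → only b (f u) ≡ 0ℚ
    h u false _ = refl
    h u true  s with () ← subst (1 ℕ.≤_) e (#⇒fixedˡ (#-sym (sep⇒# u z (subst T (sym s) tt))))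

  -- Separation from a single fixed coordinate forces the opposite value there: this has probability
  -- `ε` and makes one coordinate of `u` fixed. The other `m` coordinates stay unconstrained, as in
  -- `𝔼-affine`.
  𝔼-affine-sep : ∀ m (z : Pattern (suc m)) → #fixed z ≡ 1 → ∀ a t →
    𝔼 (suc m) (λ u → only (sep u z) (a + k u * t)) ≡ ε * (a + t + (ι m * (ε + ε)) * t)
  𝔼-affine-sep m (fixed b ∷ z) e a t = trans (cong (λ x → ε * x + δ * w) (pick b))
    (trans (cong (λ x → ε * y + δ * x) (𝔼-none m z (ℕ.suc-injective e) (λ u → a + k u * t)))
      (trans (cong (_+_ (ε * y)) (*-zeroʳ δ)) (+-identityʳ _)))
    where
    w = 𝔼 m (λ u → only (sep u z) (a + k u * t))
    y = a + t + (ι m * (ε + ε)) * t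
    full : 𝔼 m (λ z → a + ι (suc (#fixed z)) * t) ≡ y
    full = trans (𝔼-cong m λ z → affine-suc z a t) (𝔼-affine m (a + t) t)
    none : 𝔼 m (λ u → only (sep u z) (a + ι (suc (#fixed u)) * t)) ≡ 0ℚ
    none = 𝔼-none m z (ℕ.suc-injective e) (λ u → a + ι (suc (#fixed u)) * t)
    -- Only the value opposite to `b` separates; the tail of `z` has no fixed coordinate, so the
    -- other value contributes nothing.
    pick : ∀ b → 𝔼 m (λ u → only ((false xor b) ∨ sep u z) (a + ι (suc (#fixed u)) * t))
      + 𝔼 m (λ u → only ((true xor b) ∨ sep u z) (a + ι (suc (#fixed u)) * t)) ≡ y
    pick false = trans (cong₂ _+_ none full) (+-identityˡ y)
    pick true  = trans (cong₂ _+_ full none) (+-identityʳ y)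
  𝔼-affine-sep zero (free ∷ []) ()
  𝔼-affine-sep (suc m) (free ∷ z) e a t = begin
    ε * (x + x) + δ * 𝔼 (suc m) (λ u → only (sep u z) (a + k u * t))
      ≡⟨ cong₂ (λ x y → ε * (x + x) + δ * y)
           (trans (𝔼-cong (suc m) λ u → cong (only (sep u z)) (affine-suc u a t)) (𝔼-affine-sep m z e (a + t) t))
           (𝔼-affine-sep m z e a t) ⟩
    ε * (ε * (a + t + t + (ι m * (ε + ε)) * t) + ε * (a + t + t + (ι m * (ε + ε)) * t))
      + δ * (ε * (a + t + (ι m * (ε + ε)) * t))
      ≡⟨ solve 4 (λ a t e m →
           e :* (e :* (a :+ t :+ t :+ (m :* (e :+ e)) :* t) :+ e :* (a :+ t :+ t :+ (m :* (e :+ e)) :* t))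
             :+ (con 1ℚ :- (e :+ e)) :* (e :* (a :+ t :+ (m :* (e :+ e)) :* t))
           := e :* (a :+ t :+ ((con 1ℚ :+ m) :* (e :+ e)) :* t)) refl a t ε (ι m) ⟩
    ε * (a + t + ((1ℚ + ι m) * (ε + ε)) * t)
      ≡⟨ cong (λ i → ε * (a + t + (i * (ε + ε)) * t)) (sym (ι-suc m)) ⟩
    ε * (a + t + (ι (suc m) * (ε + ε)) * t) ∎
    where
    open ≡-Reasoning
    x = 𝔼 (suc m) (λ u → only (sep u z) (a + ι (suc (#fixed u)) * t))

-- The packing process

module Process (N′ : ℕ) where

  -- The form of `N` builds in `2 ≤ N` and leaves `suc N′` interior numerators; `M` counts all
  -- numerators of a coordinate.
  N M : ℕ
  N = suc (suc N′)
  M = suc N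

  ε : ℚ
  ε = + 1 / M

  ε*M : ε * ι M ≡ 1ℚ
  ε*M = /-*-ι 1 M

  0<ε : 0ℚ <ℚ ε
  0<ε = positive⁻¹ ε {{normalize-pos 1 M}}

  0≤ε : 0ℚ ≤ℚ ε
  0≤ε = <⇒≤ 0<ε

  2ε≤1 : ε + ε ≤ℚ 1ℚ
  2ε≤1 = begin
    ε + ε     ≡⟨ solve 1 (λ e → e :+ e := e :* con (ι 2)) refl ε ⟩
    ε * ι 2   ≤⟨ *-monoˡ 0≤ε (ι-mono {2} {M} (ℕ.s≤s (ℕ.s≤s ℕ.z≤n))) ⟩
    ε * ι M   ≡⟨ ε*M ⟩
    1ℚ        ∎
    where open ≤-Reasoning

  ε≤1 : ε ≤ℚ 1ℚ
  ε≤1 = ≤-trans (p≤p+q 0≤ε) 2ε≤1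

  open Mean ε 0≤ε 2ε≤1

  -- From grid positions to patterns

  cls : ℕ → Coord
  cls zero    = fixed false
  cls (suc a) = if suc a ≡ᵇ N then fixed true else free

  pat : ∀ {n} → Vec ℕ n → Pattern n
  pat = Vec.map cls

  pats : ∀ {n} → List (Vec ℕ n) → List (Pattern n)
  pats = map pat

  sepCoord≡sepC : ∀ a b → sepCoord N a b ≡ sepC (cls a) (cls b)
  sepCoord≡sepC zero    zero    = refl
  sepCoord≡sepC zero    (suc b) with suc b ≡ᵇ N
  ... | true  = refl
  ... | false = refl
  sepCoord≡sepC (suc a) zero    with suc a ≡ᵇ N
  ... | true  = refl
  ... | false = refl
  sepCoord≡sepC (suc a) (suc b) with suc a ≡ᵇ N | suc b ≡ᵇ N
  ... | true  | true  = refl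
  ... | true  | false = refl
  ... | false | _     = refl

  nonOverlap≡sep : ∀ {n} (z w : Vec ℕ n) → nonOverlap N z w ≡ sep (pat z) (pat w)
  nonOverlap≡sep []      []      = refl
  nonOverlap≡sep (a ∷ z) (b ∷ w) = cong₂ _∨_ (sepCoord≡sepC a b) (nonOverlap≡sep z w)

  addable≡fits : ∀ {n} (P : List (Vec ℕ n)) z → addable N P z ≡ fits (pats P) (pat z)
  addable≡fits []      z = refl
  addable≡fits (w ∷ P) z = cong₂ _∧_ (nonOverlap≡sep z w) (addable≡fits P z)

  ≡ᵇ-< : ∀ {i j} → i ℕ.< j → (i ≡ᵇ j) ≡ false
  ≡ᵇ-< {zero}  (ℕ.s≤s _)   = refl
  ≡ᵇ-< {suc i} (ℕ.s≤s i<j) = ≡ᵇ-< i<j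

  ≡ᵇ-refl : ∀ i → (i ≡ᵇ i) ≡ true
  ≡ᵇ-refl zero    = refl
  ≡ᵇ-refl (suc i) = ≡ᵇ-refl i

  ∑-cls : ∀ (h : Coord → ℚ) →
    ∑ (h ∘ cls) (upTo M) ≡ h (fixed false) + (ι (suc N′) * h free + h (fixed true))
  ∑-cls h = cong (_+_ (h (fixed false))) (begin
    ∑ (h ∘ cls) (applyUpTo suc N)
      ≡⟨ cong (∑ (h ∘ cls)) (sym (applyUpTo-∷ʳ suc (suc N′))) ⟩
    ∑ (h ∘ cls) (applyUpTo suc (suc N′) ∷ʳ N)
      ≡⟨ ∑-++ (h ∘ cls) (applyUpTo suc (suc N′)) (N ∷ []) ⟩
    ∑ (h ∘ cls) (applyUpTo suc (suc N′)) + (h (cls N) + 0ℚ)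
      ≡⟨ cong₂ _+_ (∑-applyUpTo (h ∘ cls) suc (h free) (suc N′)
           (λ i i<j → cong (λ b → h (if b then fixed true else free)) (≡ᵇ-< i<j)))
           (trans (+-identityʳ _) (cong (λ b → h (if b then fixed true else free)) (≡ᵇ-refl N))) ⟩
    ι (suc N′) * h free + h (fixed true) ∎)
    where open ≡-Reasoning

  -- `pat` carries the uniform distribution on the grid to the weights of `𝔼`: of the `M` numerators
  -- one is 0, one is `N`, and `suc N′` are interior.
  ∑-grid : ∀ n (f : Pattern n → ℚ) → ∑ (f ∘ pat) (grid N n) ≡ ι M ^ n * 𝔼 n f
  ∑-grid zero    f = trans (+-identityʳ (f [])) (sym (*-identityˡ (f [])))
  ∑-grid (suc n) f = begin
    ∑ (f ∘ pat) (grid N (suc n))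
      ≡⟨ ∑-concatMap (f ∘ pat) (λ a → map (a ∷_) (grid N n)) (upTo M) ⟩
    ∑ (λ a → ∑ (f ∘ pat) (map (a ∷_) (grid N n))) (upTo M)
      ≡⟨ ∑-cong (λ a → trans (∑-map (f ∘ pat) (a ∷_) (grid N n)) (∑-grid n (f ∘ (cls a ∷_)))) (upTo M) ⟩
    ∑ (h ∘ cls) (upTo M)
      ≡⟨ ∑-cls h ⟩
    p * x + (ν * (p * z) + p * y)
      ≡⟨ solve 5 (λ p x y z ν → p :* x :+ (ν :* (p :* z) :+ p :* y) := p :* (con 1ℚ :* (x :+ y) :+ ν :* z)) refl
           p x y z ν ⟩
    p * (1ℚ * (x + y) + ν * z)
      ≡⟨ cong₂ (λ a b → p * (a * (x + y) + b * z)) (sym ε*M) ν≡ ⟩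
    p * ((ε * ι M) * (x + y) + (δ * ι M) * z)
      ≡⟨ solve 7 (λ p x y z e d m → p :* ((e :* m) :* (x :+ y) :+ (d :* m) :* z)
           := (m :* p) :* (e :* (x :+ y) :+ d :* z)) refl
           p x y z ε δ (ι M) ⟩
    (ι M * p) * 𝔼 (suc n) f ∎
    where
    open ≡-Reasoning
    p = ι M ^ n
    h : Coord → ℚ
    h c = p * 𝔼 n (f ∘ (c ∷_))
    x = 𝔼 n (f ∘ (fixed false ∷_))
    y = 𝔼 n (f ∘ (fixed true ∷_))
    z = 𝔼 n (f ∘ (free ∷_))
    ν = ι (suc N′)
    ν≡ : ν ≡ δ * ι M
    ν≡ = sym (begin
      δ * ι M                         ≡⟨ solve 2 (λ e m → (con 1ℚ :- (e :+ e)) :* m := m :- (e :* m :+ e :* m)) refl ε (ι M) ⟩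
      ι M - (ε * ι M + ε * ι M)       ≡⟨ cong₂ (λ a b → a - (b + b)) (ι-+ 2 (suc N′)) ε*M ⟩
      (ι 2 + ν) - (1ℚ + 1ℚ)           ≡⟨ solve 1 (λ v → (con (ι 2) :+ v) :- (con 1ℚ :+ con 1ℚ) := v) refl ν ⟩
      ν ∎)

  -- The recursion for the expected size

  module _ {n : ℕ} where

    V : ℕ → List (Vec ℕ n) → ℚ
    V = expFrom N n

    -- In multiplied form the recursion also holds for a saturated packing, where both sides vanish.
    V-average : ∀ f P → V (suc f) P * ι (length (admissible N n P)) ≡ ∑ (λ w → V f (w ∷ P)) (admissible N n P)
    V-average f P with admissible N n P
    ... | []     = *-zeroʳ (ι (length P))
    ... | z ∷ zs = trans (*-assoc s (+ 1 / suc (length zs)) (ι (suc (length zs))))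
      (trans (cong (_*_ s) (/-*-ι 1 (suc (length zs)))) (*-identityʳ s))
      where s = ∑ (λ w → V f (w ∷ P)) (z ∷ zs)

    V-terminal : ∀ f P → admissible N n P ≡ [] → V f P ≡ ι (length P)
    V-terminal zero    P e = refl
    V-terminal (suc f) P e rewrite e = refl

    -- The probability that a uniform cube can be added.
    mass : List (Pattern n) → ℚ
    mass Q = 𝔼 n (λ u → only (fits Q u) 1ℚ)

    ∑-admissible : ∀ P (f : Pattern n → ℚ) →
      ∑ (f ∘ pat) (admissible N n P) ≡ ι M ^ n * 𝔼 n (λ u → only (fits (pats P) u) (f u))
    ∑-admissible P f = begin
      ∑ (f ∘ pat) (admissible N n P) ≡⟨ ∑-filter (addable N P) (f ∘ pat) (grid N n) ⟩
      ∑ (λ z → only (addable N P z) (f (pat z))) (grid N n)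
        ≡⟨ ∑-cong (λ z → cong (λ b → only b (f (pat z))) (addable≡fits P z)) (grid N n) ⟩
      ∑ ((λ u → only (fits (pats P) u) (f u)) ∘ pat) (grid N n) ≡⟨ ∑-grid n _ ⟩
      ι M ^ n * 𝔼 n (λ u → only (fits (pats P) u) (f u)) ∎
      where open ≡-Reasoning

    length-admissible : ∀ P → ι (length (admissible N n P)) ≡ ι M ^ n * mass (pats P)
    length-admissible P = trans (sym (trans (∑-const 1ℚ (admissible N n P)) (*-identityʳ _)))
      (∑-admissible P (λ _ → 1ℚ))

    0<M^n : 0ℚ <ℚ ι M ^ n
    0<M^n = ^-pos n (positive⁻¹ (ι M) {{normalize-pos M 1}})

    admissible-fits : ∀ P → All (λ w → T (fits (pats P) (pat w))) (admissible N n P)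
    admissible-fits P = All.map (λ {w} → subst T (addable≡fits P w))
      (all-filter (λ z → T? (addable N P z)) (grid N n))

    -- An approximation `G` of the value after the next cube, with error `E`, passes to the average
    -- over admissible cubes. Dividing by the number of grid positions turns their count into
    -- `mass`.
    average-error : ∀ f P (G E : Pattern n → ℚ) →
      (∀ w → T (fits (pats P) (pat w)) → ∣ V f (w ∷ P) - G (pat w) ∣ ≤ℚ E (pat w)) →
      ∣ V (suc f) P * mass (pats P) - 𝔼 n (λ u → only (fits (pats P) u) (G u)) ∣
        ≤ℚ 𝔼 n (λ u → only (fits (pats P) u) (E u))
    average-error f P G E h = *-cancelʳ 0<M^n (begin
      ∣ v * a - g ∣ * p    ≡⟨ sym (∣-∣-*ʳ (v * a) g (<⇒≤ 0<M^n)) ⟩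
      ∣ v * a * p - g * p ∣
        ≡⟨ cong₂ (λ s t → ∣ s - t ∣)
             (trans (solve 3 (λ v a p → v :* a :* p := v :* (p :* a)) refl v a p)
               (trans (cong (_*_ v) (sym (length-admissible P))) (V-average f P)))
             (trans (*-comm g p) (sym (∑-admissible P G))) ⟩
      ∣ ∑ (λ w → V f (w ∷ P)) L - ∑ (G ∘ pat) L ∣
        ≤⟨ ∑-∣-∣ (λ w → V f (w ∷ P)) (G ∘ pat) (E ∘ pat) L (All.map (λ {w} → h w) (admissible-fits P)) ⟩
      ∑ (E ∘ pat) L ≡⟨ trans (∑-admissible P E) (*-comm p _) ⟩
      𝔼 n (λ u → only (fits (pats P) u) (E u)) * p ∎)
      where
      open ≤-Reasoning
      L = admissible N n P
      p = ι M ^ n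
      v = V (suc f) P
      a = mass (pats P)
      g = 𝔼 n (λ u → only (fits (pats P) u) (G u))

-- Constants of the error bounds

module Constants (m : ℕ) where

  -- `K` is the factor from `𝔼-tail`, `B` bounds the approximating values, and `D` bounds their
  -- distance from `V` a priori. `C₁` serves packings of two cubes and `C₀` those of one; its
  -- summand `ι m * ι 4` pays for replacing 3 by `1ℚ + ι 2 * t`.
  K B D C₁ C₀ : ℚ
  K  = ι (3 ℕ.^ suc m)
  B  = ι 3 + ι (suc m) * (1ℚ + ι m * ι 2)
  D  = ι (2 ℕ.^ suc m) + B
  C₁ = D * K
  C₀ = C₁ * K + ι m * ι 4

  1≤K : 1ℚ ≤ℚ K
  1≤K = ι-mono (ℕ.m^n>0 3 (suc m))

  0≤K : 0ℚ ≤ℚ K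
  0≤K = 0≤ι (3 ℕ.^ suc m)

  0≤B : 0ℚ ≤ℚ B
  0≤B = 0≤+ (0≤ι 3) (0≤* (0≤ι (suc m)) (0≤+ (0≤ι 1) (0≤* (0≤ι m) (0≤ι 2))))

  0≤D : 0ℚ ≤ℚ D
  0≤D = 0≤+ (0≤ι (2 ℕ.^ suc m)) 0≤B

  p≤p*K : ∀ {p} → 0ℚ ≤ℚ p → p ≤ℚ p * K
  p≤p*K {p} 0≤p = subst (_≤ℚ p * K) (*-identityʳ p) (*-monoˡ 0≤p 1≤K)

  0≤C₁ : 0ℚ ≤ℚ C₁
  0≤C₁ = 0≤* 0≤D 0≤K

  D≤C₁ : D ≤ℚ C₁
  D≤C₁ = p≤p*K 0≤D

  C₁K≤C₀ : C₁ * K ≤ℚ C₀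
  C₁K≤C₀ = p≤p+q (0≤* (0≤ι m) (0≤ι 4))

  0≤C₀ : 0ℚ ≤ℚ C₀
  0≤C₀ = ≤-trans (0≤* 0≤C₁ 0≤K) C₁K≤C₀

  D≤C₀ : D ≤ℚ C₀
  D≤C₀ = ≤-trans D≤C₁ (≤-trans (p≤p*K 0≤C₁) C₁K≤C₀)

-- Saturation and a priori bounds

module Bounds (N′ : ℕ) where
  open Process N′
  open Mean ε 0≤ε 2ε≤1

  module _ {n : ℕ} where

    -- One more cube would add positive volume and break `kraft`.
    full⇒terminal : ∀ f (P : List (Vec ℕ n)) → Separated (pats P) → 2 ℕ.^ n ℕ.≤ volume (pats P) →
      V f P ≡ ι (length P)
    full⇒terminal f P s h = V-terminal f P (filter-none (λ z → T? (addable N P z)) (All.universal none (grid N n)))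
      where
      none : ∀ z → ¬ T (addable N P z)
      none z t = ℕ.<⇒≱ (ℕ.+-monoˡ-≤ (volume (pats P)) (vol>0 (pat z)))
        (ℕ.≤-trans (kraft (pat z ∷ pats P) (fits⇒All (pats P) (pat z) (subst T (addable≡fits P z) t) ∷ s)) h)

    -- A packing has at most as many cubes as its volume, and averages keep the bound. `V-bound′`
    -- receives the admissible cubes with an equation so that it can split on them.
    V-bound : ∀ f P → Separated (pats P) → ∣ V f P ∣ ≤ℚ ι (2 ℕ.^ n)
    V-bound′ : ∀ f P → Separated (pats P) → ∀ L → admissible N n P ≡ L → ∣ V (suc f) P ∣ ≤ℚ ι (2 ℕ.^ n)

    length-bound : ∀ P → Separated (pats P) → ∣ ι (length P) ∣ ≤ℚ ι (2 ℕ.^ n)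
    length-bound P s = ≤-trans (≤-reflexive (0≤p⇒∣p∣≡p (0≤ι (length P)))) (ι-mono
      (ℕ.≤-trans (subst (ℕ._≤ volume (pats P)) (length-map pat P) (length≤volume (pats P))) (kraft (pats P) s)))

    V-bound zero    P s = length-bound P s
    V-bound (suc f) P s = V-bound′ f P s (admissible N n P) refl

    V-bound′ f P s [] e = subst (λ x → ∣ x ∣ ≤ℚ ι (2 ℕ.^ n)) (sym (V-terminal (suc f) P e)) (length-bound P s)
    V-bound′ f P s (z ∷ zs) e = subst (_≤ℚ U) (cong ∣_∣ (v-0 v)) (∣-∣-divide v 0ℚ 0<l ≤-refl (begin
      ∣ v * l - 0ℚ * l ∣
        ≡⟨ cong₂ (λ x y → ∣ x - y ∣) (trans (cong (λ L → v * ι (length L)) (sym e)) (V-average f P))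
             (trans (*-zeroˡ l) (sym (trans (∑-const 0ℚ L) (*-zeroʳ (ι (length L)))))) ⟩
      ∣ ∑ (λ w → V f (w ∷ P)) L - ∑ (λ _ → 0ℚ) L ∣
        ≤⟨ ∑-∣-∣ (λ w → V f (w ∷ P)) (λ _ → 0ℚ) (λ _ → U) L (All.map bound (admissible-fits P)) ⟩
      ∑ (λ _ → U) L          ≡⟨ trans (∑-const U L) (*-comm (ι (length L)) U) ⟩
      U * ι (length L)       ≡⟨ cong (λ L → U * ι (length L)) e ⟩
      U * l                  ∎))
      where
      open ≤-Reasoning
      L = admissible N n P
      U = ι (2 ℕ.^ n)
      v = V (suc f) P
      l = ι (suc (length zs))
      0<l : 0ℚ <ℚ l
      0<l = positive⁻¹ l {{normalize-pos (suc (length zs)) 1}}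
      v-0 : ∀ x → x - 0ℚ ≡ x
      v-0 = solve 1 (λ x → x :- con 0ℚ := x) refl
      bound : ∀ {w} → T (fits (pats P) (pat w)) → ∣ V f (w ∷ P) - 0ℚ ∣ ≤ℚ U
      bound {w} t = subst (_≤ℚ U) (cong ∣_∣ (sym (v-0 (V f (w ∷ P)))))
        (V-bound f (w ∷ P) (fits⇒All (pats P) (pat w) t ∷ s))

    -- Every refinement of `p` fits as well, so the whole cylinder of `p` counts.
    mass-bound : ∀ Q p → All (p #_) Q → ε ^ #fixed p ≤ℚ mass {n} Q
    mass-bound Q p a = 𝔼-cylinder n p (λ z → only-nonneg (fits Q z) (0≤ι 1))
      (λ z r → 1≤only (fits Q z) (All⇒fits Q z (All.map (Refines-# r) a)))

    𝔼-only-const : ∀ Q c → 𝔼 n (λ u → only (fits Q u) c) ≡ c * mass Q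
    𝔼-only-const Q c = trans (𝔼-cong n λ u → only-* (fits Q u) c) (𝔼-* n c _)

    -- The precision needed after the next cube drops by one power of `ε` for each coordinate that
    -- it fixes. The result is still to be divided by the mass.
    average-close : ∀ f P (G : Pattern n → ℚ) c j → 0ℚ ≤ℚ c →
      (∀ w → All (pat w #_) (pats P) → ∣ V f (w ∷ P) - G (pat w) ∣ ≤ℚ c * ε ^ (j ∸ #fixed (pat w))) →
      ∣ V (suc f) P * mass (pats P) - 𝔼 n (λ u → only (fits (pats P) u) (G u)) ∣ ≤ℚ c * (ι (3 ℕ.^ n) * ε ^ j)
    average-close f P G c j 0≤c h = begin
      _ ≤⟨ average-error f P G E (λ w t → h w (fits⇒All (pats P) (pat w) t)) ⟩
      𝔼 n (λ u → only (fits (pats P) u) (E u))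
        ≤⟨ 𝔼-mono n (λ u → only-≤ (fits (pats P) u) (0≤* 0≤c (0≤^ (j ∸ #fixed u) 0≤ε))) ⟩
      𝔼 n E ≡⟨ 𝔼-* n c _ ⟩
      c * 𝔼 n (λ u → ε ^ (j ∸ #fixed u)) ≤⟨ *-monoˡ 0≤c (𝔼-tail n j) ⟩
      c * (ι (3 ℕ.^ n) * ε ^ j) ∎
      where
      open ≤-Reasoning
      E : Pattern n → ℚ
      E u = c * ε ^ (j ∸ #fixed u)

  -- Expansions after two cubes, one cube and none

  module Stages (m : ℕ) where
    open Constants m
    n : ℕ
    n = suc m

    -- With this slope the function 1 + k z · t of the first cube z is within the admissible error of
    -- V [z] for every k z, and its mean is exactly the claimed expansion.
    t : ℚ
    t = 1ℚ + ι m * (ε + ε)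

    1≤t : 1ℚ ≤ℚ t
    1≤t = p≤p+q (0≤* (0≤ι m) (0≤+ 0≤ε 0≤ε))

    0≤t : 0ℚ ≤ℚ t
    0≤t = ≤-trans (0≤ι 1) 1≤t

    t≤ : t ≤ℚ 1ℚ + ι m * ι 2
    t≤ = +-monoʳ-≤ 1ℚ (*-monoˡ (0≤ι m) (+-mono-≤ ε≤1 ε≤1))

    -- Enough where the next cube fixes so many coordinates that its probability alone gives the
    -- required order.
    crude : ∀ f (P : List (Vec ℕ n)) → Separated (pats P) → ∀ {g} → 0ℚ ≤ℚ g → g ≤ℚ B → ∣ V f P - g ∣ ≤ℚ D
    crude f P s {g} 0≤g g≤B = ≤-trans (∣p-q∣≤∣p∣+∣q∣ (V f P) g)
      (+-mono-≤ (V-bound f P s) (subst (_≤ℚ B) (sym (0≤p⇒∣p∣≡p 0≤g)) g≤B))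

    3≤B : ι 3 ≤ℚ B
    3≤B = p≤p+q (0≤* (0≤ι (suc m)) (0≤+ (0≤ι 1) (0≤* (0≤ι m) (0≤ι 2))))

    affine≤B : ∀ (z : Pattern n) {x} → 0ℚ ≤ℚ x → x ≤ℚ t → 1ℚ + k z * x ≤ℚ B
    affine≤B z {x} 0≤x x≤t = +-mono-≤ (ι-mono {1} {3} (ℕ.s≤s ℕ.z≤n))
      (≤-trans (*-monoˡ (0≤ι (#fixed z)) (≤-trans x≤t t≤))
        (*-monoʳ (0≤+ (0≤ι 1) (0≤* (0≤ι m) (0≤ι 2))) (ι-mono (#fixed≤ z))))

    0≤affine : ∀ (z : Pattern n) {x} → 0ℚ ≤ℚ x → 0ℚ ≤ℚ 1ℚ + k z * x
    0≤affine z 0≤x = 0≤+ (0≤ι 1) (0≤* (0≤ι (#fixed z)) 0≤x)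

    exact : ∀ {p q c} j → 0ℚ ≤ℚ c → p ≡ q → ∣ p - q ∣ ≤ℚ c * ε ^ j
    exact j 0≤c e = ≤-trans (≤-reflexive (∣p-p∣ e)) (0≤* 0≤c (0≤^ j 0≤ε))

    -- With that many fixed coordinates the truncated exponent is 0, so a constant bound suffices.
    at-zero : ∀ c j → c ≡ c * ε ^ (0 ∸ j)
    at-zero c j = trans (sym (*-identityʳ c)) (cong (λ i → c * ε ^ i) (sym (ℕ.0∸n≡0 j)))

    -- The gap of one quarter has mass at least `ε ^ 2`. A next cube with two fixed coordinates
    -- fills it, giving exactly 3; one with more has probability of order `ε ^ 3`. Division by the
    -- mass leaves order `ε`.
    stage₂ : ∀ f (u z : Vec ℕ n) → pat u # pat z → #fixed (pat u) ℕ.+ #fixed (pat z) ≡ 3 →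
      ∣ V (suc f) (u ∷ z ∷ []) - ι 3 ∣ ≤ℚ C₁ * ε ^ 1
    stage₂ f u z s e with partner₂ (pat u) (pat z) e s | shares-3 (pat u) (pat z) e s
    ... | p , ep , p#u , p#z | a , b , su , sz , ab = ∣-∣-divide (V (suc f) P) (ι 3) (^-pos 2 0<ε)
      (subst (λ j → ε ^ j ≤ℚ mass Q) ep (mass-bound Q p (p#u ∷ p#z ∷ [])))
      (subst₂ _≤ℚ_ (cong (λ x → ∣ V (suc f) P * mass Q - x ∣) (𝔼-only-const Q (ι 3)))
        (solve 3 (λ d k e → d :* (k :* (e :* (e :* (e :* con 1ℚ))))
          := ((d :* k) :* (e :* con 1ℚ)) :* (e :* (e :* con 1ℚ))) refl D K ε)
        (average-close f P (λ _ → ι 3) D 3 0≤D (λ v a → near v a (#fixed (pat v)) refl)))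
      where
      P = u ∷ z ∷ []
      Q = pats P
      sQ : Separated Q
      sQ = (s ∷ []) ∷ [] ∷ []
      near : ∀ v → All (pat v #_) Q → ∀ j → #fixed (pat v) ≡ j → ∣ V f (v ∷ P) - ι 3 ∣ ≤ℚ D * ε ^ (3 ∸ j)
      near v (v#u ∷ _) 0 ev with () ← subst (1 ℕ.≤_) ev (#⇒fixedˡ v#u)
      -- A half does not fit on top of three quarters.
      near v h 1 ev = ⊥-elim (overfull (pat v ∷ Q) (h ∷ sQ)
        (trans (volume₃ {v = pat v} {pat u} {pat z} {2} {a} {b} (share₁ (pat v) ev) su sz)
          (cong (λ x → (2 ℕ.+ x) ℕ.* 2 ℕ.^ n) ab)))
      -- The last quarter is filled: three cubes, saturated.
      near v h 2 ev = exact 1 0≤D (full⇒terminal f (v ∷ P) (h ∷ sQ) (four-shares (pat v ∷ Q)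
        (trans (volume₃ {v = pat v} {pat u} {pat z} {1} {a} {b} (share₂ (pat v) ev) su sz)
          (cong (λ x → (1 ℕ.+ x) ℕ.* 2 ℕ.^ n) ab))))
      near v h (suc (suc (suc j))) ev = subst (∣ V f (v ∷ P) - ι 3 ∣ ≤ℚ_) (at-zero D j)
        (crude f (v ∷ P) (h ∷ sQ) (0≤ι 3) 3≤B)

    -- The mass is at least `ε`. A next cube with one fixed coordinate leads to `stage₂`; one with
    -- more has probability of order `ε ^ 2`, which division by the mass turns into order `ε`.
    stage₁₂ : ∀ f (z : Vec ℕ n) → #fixed (pat z) ≡ 2 →
      ∣ V (suc (suc f)) (z ∷ []) - ι 3 ∣ ≤ℚ C₁ * K * ε ^ 1
    stage₁₂ f z e with partner (pat z) (subst (1 ℕ.≤_) (sym e) (ℕ.s≤s ℕ.z≤n))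
    ... | p , ep , p#z = ∣-∣-divide (V (suc (suc f)) P) (ι 3) (^-pos 1 0<ε)
      (subst (λ j → ε ^ j ≤ℚ mass Q) ep (mass-bound Q p (p#z ∷ [])))
      (subst₂ _≤ℚ_ (cong (λ x → ∣ V (suc (suc f)) P * mass Q - x ∣) (𝔼-only-const Q (ι 3)))
        (solve 3 (λ d k e → d :* (k :* (e :* (e :* con 1ℚ)))
          := ((d :* k) :* (e :* con 1ℚ)) :* (e :* con 1ℚ)) refl C₁ K ε)
        (average-close (suc f) P (λ _ → ι 3) C₁ 2 0≤C₁ (λ v a → near v a (#fixed (pat v)) refl)))
      where
      P = z ∷ []
      Q = pats P
      near : ∀ v → All (pat v #_) Q → ∀ j → #fixed (pat v) ≡ j → ∣ V (suc f) (v ∷ P) - ι 3 ∣ ≤ℚ C₁ * ε ^ (2 ∸ j)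
      near v (v#z ∷ _) 0 ev with () ← subst (1 ℕ.≤_) ev (#⇒fixedˡ v#z)
      near v (v#z ∷ _) 1 ev = stage₂ f v z v#z (cong₂ ℕ._+_ ev e)
      near v h (suc (suc j)) ev = subst (∣ V (suc f) (v ∷ P) - ι 3 ∣ ≤ℚ_)
        (at-zero C₁ j)
        (≤-trans (crude (suc f) (v ∷ P) (h ∷ [] ∷ []) (0≤ι 3) 3≤B) D≤C₁)

    -- The mass is exactly `ε`. A next cube with `j` fixed coordinates leads to `1 + j`, exactly for
    -- `j = 1` and up to order `ε` for `j = 2`, so the mean from `𝔼-affine-sep` with slope 1,
    -- divided by `ε`, is the value.
    stage₁₁ : ∀ f (z : Vec ℕ n) → #fixed (pat z) ≡ 1 →
      ∣ V (suc (suc f)) (z ∷ []) - (1ℚ + t) ∣ ≤ℚ C₁ * K * ε ^ 2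
    stage₁₁ f z e = ∣-∣-divide (V (suc (suc f)) P) (1ℚ + t) 0<ε (≤-reflexive (sym mass≡))
      (subst₂ _≤ℚ_ (cong (λ x → ∣ V (suc (suc f)) P * mass Q - x ∣) target)
        (solve 3 (λ d k e → d :* (k :* (e :* (e :* (e :* con 1ℚ))))
          := ((d :* k) :* (e :* (e :* con 1ℚ))) :* e) refl C₁ K ε)
        (average-close (suc f) P (λ u → 1ℚ + k u * 1ℚ) C₁ 3 0≤C₁ (λ v a → near v a (#fixed (pat v)) refl)))
      where
      P = z ∷ []
      Q = pats P
      -- The constant 1 is the affine function with slope 0.
      mass≡ : mass Q ≡ ε
      mass≡ = trans (𝔼-cong n λ u → trans (cong (λ b → only b 1ℚ) (∧-identityʳ (sep u (pat z))))
          (cong (only (sep u (pat z))) (solve 1 (λ k → con 1ℚ := con 1ℚ :+ k :* con 0ℚ) refl (k u))))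
        (trans (𝔼-affine-sep m (pat z) e 1ℚ 0ℚ)
          (solve 2 (λ e x → e :* (con 1ℚ :+ con 0ℚ :+ x :* con 0ℚ) := e) refl ε (ι m * (ε + ε))))
      target : 𝔼 n (λ u → only (fits Q u) (1ℚ + k u * 1ℚ)) ≡ (1ℚ + t) * mass Q
      target = trans (𝔼-cong n λ u → cong (λ b → only b (1ℚ + k u * 1ℚ)) (∧-identityʳ (sep u (pat z))))
        (trans (𝔼-affine-sep m (pat z) e 1ℚ 1ℚ)
          (trans (solve 2 (λ e x → e :* (con 1ℚ :+ con 1ℚ :+ x :* con 1ℚ)
              := (con 1ℚ :+ (con 1ℚ :+ x)) :* e) refl ε (ι m * (ε + ε)))
            (cong (_*_ (1ℚ + t)) (sym mass≡))))
      near : ∀ v → All (pat v #_) Q → ∀ j → #fixed (pat v) ≡ j →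
        ∣ V (suc f) (v ∷ P) - (1ℚ + k (pat v) * 1ℚ) ∣ ≤ℚ C₁ * ε ^ (3 ∸ j)
      near v (v#z ∷ _) 0 ev with () ← subst (1 ℕ.≤_) ev (#⇒fixedˡ v#z)
      -- Two halves saturate the packing.
      near v h 1 ev = exact 2 0≤C₁ (trans
        (full⇒terminal (suc f) (v ∷ P) (h ∷ [] ∷ []) (four-shares (pat v ∷ Q)
          (volume₂ {u = pat v} {pat z} {2} {2} (share₁ (pat v) ev) (share₁ (pat z) e))))
        (cong (λ i → 1ℚ + ι i * 1ℚ) (sym ev)))
      near v (v#z ∷ _) 2 ev = subst (λ g → ∣ V (suc f) (v ∷ P) - g ∣ ≤ℚ C₁ * ε ^ 1)
        (cong (λ i → 1ℚ + ι i * 1ℚ) (sym ev))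
        (stage₂ f v z v#z (cong₂ ℕ._+_ ev e))
      near v h (suc (suc (suc j))) ev = subst (∣ V (suc f) (v ∷ P) - (1ℚ + k (pat v) * 1ℚ) ∣ ≤ℚ_)
        (at-zero C₁ j)
        (≤-trans (crude (suc f) (v ∷ P) (h ∷ [] ∷ []) (0≤affine (pat v) (0≤ι 1)) (affine≤B (pat v) (0≤ι 1) 1≤t))
          D≤C₁)

    -- The empty packing has mass 1, so no power of `ε` is lost in a division, and the affine
    -- approximation has the mean given by `𝔼-affine`.
    stage₀ : ∀ f → ∣ V {n} (suc (suc (suc f))) [] - (1ℚ + (ι n * (ε + ε)) * t) ∣ ≤ℚ C₀ * K * ε ^ 3
    stage₀ f = subst₂ (λ x y → ∣ x - y ∣ ≤ℚ C₀ * K * ε ^ 3)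
      (trans (cong (_*_ v₀) (𝔼-const n 1ℚ)) (*-identityʳ v₀)) (𝔼-affine n 1ℚ t)
      (subst (∣ v₀ * mass {n} [] - 𝔼 n (λ u → 1ℚ + k u * t) ∣ ≤ℚ_) (sym (*-assoc C₀ K (ε ^ 3)))
        (average-close (suc (suc f)) [] (λ u → 1ℚ + k u * t) C₀ 3 0≤C₀ (λ v _ → near v (#fixed (pat v)) refl)))
      where
      v₀ = V {n} (suc (suc (suc f))) []
      near : ∀ z j → #fixed (pat z) ≡ j →
        ∣ V (suc (suc f)) (z ∷ []) - (1ℚ + k (pat z) * t) ∣ ≤ℚ C₀ * ε ^ (3 ∸ j)
      -- A cube without fixed coordinates covers every vertex and blocks all others.
      near z 0 e = exact 3 0≤C₀ (trans
        (full⇒terminal (suc (suc f)) (z ∷ []) ([] ∷ []) (ℕ.≤-reflexive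
          (trans (sym (vol*2^#fixed (pat z))) (trans (cong (λ i → vol (pat z) ℕ.* 2 ℕ.^ i) e)
            (trans (ℕ.*-identityʳ _) (sym (ℕ.+-identityʳ _)))))))
        (trans (solve 1 (λ t → con 1ℚ := con 1ℚ :+ con 0ℚ :* t) refl t) (cong (λ i → 1ℚ + ι i * t) (sym e))))
      near z 1 e = subst (λ g → ∣ V (suc (suc f)) (z ∷ []) - g ∣ ≤ℚ C₀ * ε ^ 2)
        (trans (cong (_+_ 1ℚ) (sym (*-identityˡ t))) (cong (λ i → 1ℚ + ι i * t) (sym e)))
        (≤-trans (stage₁₁ f z e) (*-monoʳ (0≤^ 2 0≤ε) C₁K≤C₀))
      -- The value is near 3; replacing 3 by `1ℚ + ι 2 * t` costs `4 m ε`, within the order `ε`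
      -- allowed here.
      near z 2 e = begin
        ∣ v - (1ℚ + k (pat z) * t) ∣
          ≡⟨ cong (λ i → ∣ v - (1ℚ + ι i * t) ∣) e ⟩
        ∣ v - (1ℚ + ι 2 * t) ∣
          ≤⟨ ∣-∣-triangle v (ι 3) (1ℚ + ι 2 * t) ⟩
        ∣ v - ι 3 ∣ + ∣ ι 3 - (1ℚ + ι 2 * t) ∣
          ≤⟨ +-mono-≤ (stage₁₂ f z e) (≤-reflexive gap) ⟩
        C₁ * K * ε ^ 1 + (ι m * ι 4) * ε ^ 1
          ≡⟨ sym (*-distribʳ-+ (ε ^ 1) (C₁ * K) (ι m * ι 4)) ⟩
        C₀ * ε ^ 1 ∎
        where
        open ≤-Reasoning
        v = V (suc (suc f)) (z ∷ [])
        gap : ∣ ι 3 - (1ℚ + ι 2 * t) ∣ ≡ (ι m * ι 4) * ε ^ 1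
        gap = trans (cong ∣_∣ (solve 2 (λ m e → con (ι 3) :- (con 1ℚ :+ con (ι 2) :* (con 1ℚ :+ m :* (e :+ e)))
            := :- ((m :* con (ι 4)) :* (e :* con 1ℚ))) refl (ι m) ε))
          (trans (∣-p∣≡∣p∣ _) (0≤p⇒∣p∣≡p (0≤* (0≤* (0≤ι m) (0≤ι 4)) (0≤^ 1 0≤ε))))
      near z (suc (suc (suc j))) e = subst (∣ V (suc (suc f)) (z ∷ []) - (1ℚ + k (pat z) * t) ∣ ≤ℚ_)
        (at-zero C₀ j)
        (≤-trans (crude (suc (suc f)) (z ∷ []) ([] ∷ []) (0≤affine (pat z) 0≤t) (affine≤B (pat z) 0≤t ≤-refl)) D≤C₀)

-- The claimed form of the expansion and the fuel

expansion : ∀ N′ m → let M = 3 ℕ.+ N′; ε = + 1 / M in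
  1ℚ + (ι (suc m) * (ε + ε)) * (1ℚ + ι m * (ε + ε))
    ≡ (+ 1 / 1) + (+ (2 ℕ.* suc m) / M) + (+ (4 ℕ.* suc m ℕ.* m) / (M ℕ.^ 2))
expansion N′ m = sym (begin
  1ℚ + (+ (2 ℕ.* suc m) / M) + (+ (4 ℕ.* suc m ℕ.* m) / (M ℕ.^ 2))
    ≡⟨ cong₂ (λ x y → 1ℚ + x + y)
         (trans (/≡ι* (2 ℕ.* suc m) M) (cong (_* ε) (ι-* 2 (suc m))))
         (trans (/≡ι* (4 ℕ.* suc m ℕ.* m) (M ℕ.^ 2))
           (cong₂ _*_ (trans (ι-* (4 ℕ.* suc m) m) (cong (_* ι m) (ι-* 4 (suc m)))) (1/-^ M 2))) ⟩
  1ℚ + (ι 2 * ι (suc m)) * ε + ((ι 4 * ι (suc m)) * ι m) * (ε * (ε * 1ℚ))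
    ≡⟨ solve 3 (λ n m e → con 1ℚ :+ (con (ι 2) :* n) :* e :+ ((con (ι 4) :* n) :* m) :* (e :* (e :* con 1ℚ))
         := con 1ℚ :+ (n :* (e :+ e)) :* (con 1ℚ :+ m :* (e :+ e))) refl (ι (suc m)) (ι m) ε ⟩
  1ℚ + (ι (suc m) * (ε + ε)) * (1ℚ + ι m * (ε + ε)) ∎)
  where
  open ≡-Reasoning
  M = 3 ℕ.+ N′
  ε = + 1 / M

-- `stage₀` unfolds the recursion three times and holds for any remaining fuel, so the fuel is split
-- as 3 plus the rest.
fuel≥3 : ∀ N′ m → 3 ℕ.≤ (3 ℕ.+ N′) ℕ.^ suc m
fuel≥3 N′ m = ℕ.≤-trans (ℕ.m≤m+n 3 N′)
  (ℕ.m≤m*n (3 ℕ.+ N′) ((3 ℕ.+ N′) ℕ.^ m) {{ℕ.m^n≢0 (3 ℕ.+ N′) m}})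

theorem3 : (n : ℕ) → 1 ≤ n →
    ∃ λ (C : ℚ) → ∃ λ (N₀ : ℕ) → (N : ℕ) → 2 ≤ N → N₀ ≤ N →
    ∣ EM N n - ((+ 1 / 1) + (+ (2 ℕ.* n) / ℕ.suc N)
    + (+ (4 ℕ.* n ℕ.* (n ∸ 1)) / (ℕ.suc N ℕ.^ 2))) ∣
    ℚ.≤ C * (+ 1 / (ℕ.suc N ℕ.^ 3))
-- The bound holds for all `N` from 2 on, hence the threshold 0; the constant depends on `m` only.
theorem3 (suc m) _ = C₀ * K , 0 , bound
  where
  open Constants m
  bound : ∀ N → 2 ℕ.≤ N → 0 ℕ.≤ N →
    ∣ EM N (suc m) - ((+ 1 / 1) + (+ (2 ℕ.* suc m) / suc N) + (+ (4 ℕ.* suc m ℕ.* m) / (suc N ℕ.^ 2))) ∣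
      ℚ.≤ C₀ * K * (+ 1 / (suc N ℕ.^ 3))
  bound (suc (suc N′)) (ℕ.s≤s (ℕ.s≤s _)) _ =
    subst₂ _≤ℚ_ (cong₂ (λ f x → ∣ expFrom (2 ℕ.+ N′) (suc m) f [] - x ∣)
        (ℕ.m+[n∸m]≡n (fuel≥3 N′ m)) (expansion N′ m))
      (cong (_*_ (C₀ * K)) (sym (1/-^ (3 ℕ.+ N′) 3)))
      (Bounds.Stages.stage₀ N′ m ((3 ℕ.+ N′) ℕ.^ suc m ∸ 3))
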